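{- Let $m,n$ be positive integers and let $c\ge 0$, $d\ge 1$ be integers with $\gcd(c,d)=1$ and $0<\lfloor \frac{n}{d}\rfloor\le\lfloor\frac{m}{c}\rfloor$. Let $\bar n\in\{0,1,\dots,d-1\}$ be the remainder of $n$ modulo $d$. For the one-move rider $\mathbb{P}$ with move set $\mathbf{M}=\{(c,d)\}$ on the $m\times n$ rectangular board and any integer $q\ge 1$, the number $u_{\mathbb{P}}(q;m,n)$ of nonattacking configurations of $q$ unlabelled pieces equals $$\sum_{k+j+x_1+\dots+x_{2cd}=q}\binom{(d-\bar n)\left(m-c\lfloor\tfrac{n}{d}\rfloor\right)+c(\bar n+d)}{j}\left\lfloor\tfrac{n}{d}\right\rfloor^{j}\binom{\bar n\left(m-c\lfloor\tfrac{n}{d}\rfloor\right)}{k}\left(\left\lfloor\tfrac{n}{d}\right\rfloor+1\right)^{k}\prod_{i=1}^{2cd}\left[{\lfloor\tfrac{n}{d}\rfloor\atop \lfloor\tfrac{n}{d}\rfloor-x_i}\right],$$ where the sum is over all tuples $(k,j,x_1,\dots,x_{2cd})$ of nonnegative integers with $k+j+x_1+\dots+x_{2cd}=q$, and the square brackets denote unsigned Stirling numbers of the first kind.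
   Context: The $m\times n$ board is $\{1,\dots,m\}\times\{1,\dots,n\}\subset\mathbb{Z}^2$. A one-move rider with move set $\mathbf{M}=\{(c,d)\}$ is a piece that, from a lattice point $z\in\mathbb{Z}^2$, attacks every lattice point $z+k(c,d)$ with $k\in\mathbb{Z}$, $k\neq 0$. A nonattacking configuration of $q$ pieces is a $q$-element subset of the board in which no point is attacked by a piece placed at another point of the subset; $u_{\mathbb{P}}(q;m,n)$ is the number of such subsets. The unsigned Stirling number of the first kind $\left[{N\atop r}\right]$ is the number of permutations of $N$ elements with exactly $r$ cycles, equivalently $x(x+1)\cdots(x+N-1)=\sum_{r}\left[{N\atop r}\right]x^r$; it is $0$ when $r<0$ or $r>N$. Binomial coefficients $\binom{a}{b}$ with integers $a,b\ge 0$ are $0$ when $b>a$. When $c=0$ (so $d=1$), $\lfloor m/c\rfloor$ is read as $+\infty$, so the inequality $\lfloor n/d\rfloor\le\lfloor m/c\rfloor$ holds automatically, and the product over $i$ is empty (equal to $1$). -}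

module Defs where

open import Data.Fin using (Fin; toℕ; remQuot)
import Data.Fin.Properties as Fin
open import Data.Fin.Subset using (Subset; inside; outside; _∈_; ∣_∣)
open import Data.Fin.Subset.Properties using (_∈?_)
open import Data.Integer using (ℤ; +_; -[1+_]; 0ℤ)
import Data.Integer as ℤ
import Data.Integer.Properties as ℤ
open import Data.Integer.Divisibility.Signed using (divides; _∣?_)
open import Data.List using (List; []; _∷_; _++_; map; concatMap; filter; length; upTo)
open import Data.Nat using (ℕ; zero; suc; _+_; _*_; _∸_; _^_; _/_; _%_; NonZero; _≟_)
open import Data.Nat.Combinatorics using (_C_)
open import Data.Nat.ListAction using (sum; product)
open import Data.Product using (∃; _×_; _,_)
import Data.Product.Properties as Product
open import Data.Vec using (Vec; []; _∷_; toList)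
open import Relation.Binary.Definitions using (Decidable)
open import Relation.Binary.PropositionalEquality using (_≡_; _≢_; refl; sym; trans; cong)
open import Relation.Nullary using (¬_; yes; no; ¬?; _→-dec_; _×-dec_)
import Relation.Unary as Unary

Point : Set
Point = ℤ × ℤ

_+[_]_ : Point → ℤ → ℕ × ℕ → Point
(x , y) +[ k ] (c , d) = (x ℤ.+ k ℤ.* + c , y ℤ.+ k ℤ.* + d)

-- Attacks M z w: the one-move rider with move set {M}, placed at z, attacks w.
Attacks : ℕ × ℕ → Point → Point → Set
Attacks M z w = ∃ λ (k : ℤ) → k ≢ 0ℤ × w ≡ z +[ k ] M

-- Fin (m * n) indexes the points of {1,…,m} × {1,…,n}, so that sets of board
-- points are elements of Subset (m * n).
point : ∀ m n → Fin (m * n) → Point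
point m n s = let (i , j) = remQuot {m} n s in (+ suc (toℕ i) , + suc (toℕ j))

NonAttacking : ℕ × ℕ → ∀ m n → Subset (m * n) → Set
NonAttacking M m n S =
  ∀ s → s ∈ S → ∀ t → t ∈ S → s ≢ t → ¬ Attacks M (point m n s) (point m n t)

IsConfiguration : ℕ × ℕ → ℕ → ∀ m n → Subset (m * n) → Set
IsConfiguration M q m n S = ∣ S ∣ ≡ q × NonAttacking M m n S

private
  [a+b]-a≡b : ∀ a b → (a ℤ.+ b) ℤ.- a ≡ b
  [a+b]-a≡b a b =
    trans (cong (ℤ._- a) (ℤ.+-comm a b))
    (trans (ℤ.+-assoc b a (ℤ.- a))
    (trans (cong (λ e → b ℤ.+ e) (ℤ.+-inverseʳ a)) (ℤ.+-identityʳ b)))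

-- As d ≠ 0, the only candidate for the multiplier is (y′ - y) / d.
attacks? : ∀ c d .{{_ : NonZero d}} → Decidable (Attacks (c , d))
attacks? c d@(suc _) (x , y) (x′ , y′) with + d ∣? (y′ ℤ.- y)
... | no  d∤ = no λ { (k , _ , refl) → d∤ (divides k ([a+b]-a≡b y (k ℤ.* + d))) }
... | yes (divides k eq)
  with ¬? (k ℤ.≟ 0ℤ)
     ×-dec Product.≡-dec ℤ._≟_ ℤ._≟_ (x′ , y′) ((x , y) +[ k ] (c , d))
...   | yes p = yes (k , p)
...   | no ¬p = no λ { (k′ , k′≢0 , refl) → ¬p (unique k′ k′≢0 eq) }
  where
  unique : ∀ k′ → k′ ≢ 0ℤ → (y ℤ.+ k′ ℤ.* + d) ℤ.- y ≡ k ℤ.* + d →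
           k ≢ 0ℤ × (x , y) +[ k′ ] (c , d) ≡ (x , y) +[ k ] (c , d)
  unique k′ k′≢0 e
    with refl ← ℤ.*-cancelʳ-≡ k′ k (+ d) (trans (sym ([a+b]-a≡b y _)) e)
    = k′≢0 , refl

isConfiguration? : ∀ c d .{{_ : NonZero d}} q m n →
                   Unary.Decidable (IsConfiguration (c , d) q m n)
isConfiguration? c d q m n S =
  (∣ S ∣ ≟ q) ×-dec
  Fin.all? (λ s → (s ∈? S) →-dec
  Fin.all? (λ t → (t ∈? S) →-dec
  (¬? (s Fin.≟ t) →-dec ¬? (attacks? c d (point m n s) (point m n t)))))

allSubsets : ∀ N → List (Subset N)
allSubsets zero    = [] ∷ []
allSubsets (suc N) = map (outside ∷_) (allSubsets N) ++ map (inside ∷_) (allSubsets N)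

-- u_ℙ(q; m, n) for the one-move rider ℙ with move set {(c , d)}.
u : ∀ c d .{{_ : NonZero d}} (q m n : ℕ) → ℕ
u c d q m n = length (filter (isConfiguration? c d q m n) (allSubsets (m * n)))

-- A polynomial (or power series) over ℕ, given by its coefficients:
-- f r is the coefficient of x ^ r.
Coefficients : Set
Coefficients = ℕ → ℕ

1ₚ : Coefficients
1ₚ zero    = 1
1ₚ (suc _) = 0

x+_ : ℕ → Coefficients
(x+ a) 0             = a
(x+ a) 1             = 1
(x+ a) (suc (suc _)) = 0

_*ₚ_ : Coefficients → Coefficients → Coefficients
(f *ₚ g) r = sum (map (λ i → f i * g (r ∸ i)) (upTo (suc r)))

-- x (x + 1) ⋯ (x + N - 1)
risingFactorial : ℕ → Coefficients
risingFactorial zero    = 1ₚ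
risingFactorial (suc N) = risingFactorial N *ₚ (x+ N)

-- Unsigned Stirling numbers of the first kind, as the coefficients of the
-- rising factorial; the lower index may be negative.
stirling₁ : ℕ → ℤ → ℕ
stirling₁ N (+ r)    = risingFactorial N r
stirling₁ N -[1+ _ ] = 0

-- All tuples in ℕ ^ l with entries summing to q, each listed once.
tuplesWithSum : ∀ l → ℕ → List (Vec ℕ l)
tuplesWithSum zero    zero    = [] ∷ []
tuplesWithSum zero    (suc _) = []
tuplesWithSum (suc l) q       =
  concatMap (λ a → map (a ∷_) (tuplesWithSum l (q ∸ a))) (upTo (suc q))

-- The summand for the tuple (k , j , x₁ , … , x_{2cd}).  The differences d ∸ n̄
-- and m ∸ c * N are never truncated when c * ⌊ n / d ⌋ ≤ m.
term : ∀ c d .{{_ : NonZero d}} (m n : ℕ) → Vec ℕ (2 + 2 * c * d) → ℕ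
term c d m n (k ∷ j ∷ xs) =
    (((d ∸ n̄) * (m ∸ c * N) + c * (n̄ + d)) C j) * N ^ j
  * ((n̄ * (m ∸ c * N)) C k) * (N + 1) ^ k
  * product (map (λ x → stirling₁ N (N ℤ.⊖ x)) (toList xs))
  where
  N = n / d
  n̄ = n % d

{-# OPTIONS --safe #-}

-- Colour every cell (i , j) of the board by d i - c j, that is, by its line in
-- direction (c , d).  A configuration is a set of q cells of distinct colours,
-- so there are e_q(h₁, h₂, …) of them, where e_q is the elementary symmetric
-- polynomial and h₁, h₂, … are the lengths of the lines.  Deleting the first
-- cell of every line of an (m + c) × (n + d) board leaves a translate of the
-- m × n board, which yields the lengths by induction on ⌊ n / d ⌋.  Finally
-- e_x(1, …, N - 1) is the Stirling number [ N , N - x ], so that expanding e_q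
-- over the blocks of equal lengths and the 2 c d staircases 1, …, N - 1 gives
-- the sum.
module Submission where

open import Defs
open import Data.Fin using (Fin; zero; suc; toℕ; remQuot; combine; _↑ˡ_; _↑ʳ_)
import Data.Fin.Properties as Fin
open import Data.Fin.Subset using (Subset; inside; outside; ∣_∣) renaming (_∈_ to _∈ₛ_)
open import Data.Integer using (ℤ; _⊖_; -[1+_])
import Data.Integer as ℤ
import Data.Integer.Properties as ℤ
open import Data.List
  using (List; []; _∷_; _++_; map; concat; concatMap; filter; foldr; length; replicate; tabulate;
         upTo; applyUpTo; cartesianProduct)
import Data.List.Membership.DecPropositional as DecMembership
open import Data.List.Membership.Propositional using (_∈_; _∉_)
open import Data.List.Membership.Propositional.Properties
  using (∈-∃++; ∈-++⁺ˡ; ∈-++⁺ʳ; ∈-++⁻; ∈-map⁺; ∈-map⁻; ∈-upTo⁺; ∈-upTo⁻;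
         ∈-cartesianProduct⁺; ∈-cartesianProduct⁻)
open import Data.List.Properties
  using (map-++; map-∘; map-cong; map-cong-local; map-applyUpTo; map-replicate; applyUpTo-∷ʳ;
         filter-++; filter-none; length-++; length-map; length-replicate; length-applyUpTo;
         length-upTo; tabulate-cong; ++-identityʳ)
open import Data.List.Relation.Binary.Permutation.Propositional
  using (_↭_; prep; swap; ↭-refl; ↭-sym; ↭-trans; ↭-reflexive; ↭⇒↭ₛ)
  renaming (refl to ↭refl; trans to ↭trans)
open import Data.List.Relation.Binary.Permutation.Propositional.Properties
  using (shift; shifts; ++⁺ˡ; ++⁺; ++-comm; ∷↭∷ʳ; map⁺; ↭-length; filter-↭; ∈-resp-↭)
import Data.List.Relation.Binary.Permutation.Setoid.Properties as SetoidPerm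
open import Data.List.Relation.Unary.All using ([]; _∷_)
import Data.List.Relation.Unary.All as All
import Data.List.Relation.Unary.All.Properties as All
open import Data.List.Relation.Unary.AllPairs using ([]; _∷_)
import Data.List.Relation.Unary.Any as Any
open import Data.List.Relation.Unary.Unique.Propositional using (Unique)
import Data.List.Relation.Unary.Unique.Propositional.Properties as Unique
open import Data.Nat
  using (ℕ; zero; suc; _+_; _*_; _∸_; _^_; _/_; _%_; _<_; _≤_; z≤n; s≤s; NonZero; >-nonZero⁻¹)
open import Data.Nat.Combinatorics using (_C_; nCk+nC[k+1]≡[n+1]C[k+1])
open import Data.Nat.Coprimality using (gcd≡1⇒coprime; coprime-divisor)
import Data.Nat.Coprimality as Coprime
open import Data.Nat.Divisibility using (divides)
open import Data.Nat.DivMod using (m≡m%n+[m/n]*n; m%n<n; m/n*n≤m)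
open import Data.Nat.GCD using (gcd)
open import Data.Nat.ListAction using (sum; product)
open import Data.Nat.ListAction.Properties using (sum-++)
open import Data.Nat.Properties
open import Data.Nat.Tactic.RingSolver using (solve-∀)
open import Data.Product using (∃; _×_; _,_; proj₁; proj₂; uncurry)
open import Data.Sum using (inj₁; inj₂)
open import Data.Vec using (Vec; []; _∷_; here; there)
import Data.Vec as Vec
open import Data.Vec.Properties using (toList-replicate)
open import Function using (_∘_; id; _⇔_; mk⇔; Equivalence)
open import Function.Construct.Composition using (_⇔-∘_)
open import Relation.Binary.Definitions using (DecidableEquality)
open import Relation.Binary.PropositionalEquality
  using (_≡_; _≢_; _≗_; refl; sym; trans; cong; cong₂; subst; subst₂; setoid; module ≡-Reasoning)
open import Relation.Nullary using (¬_; Dec; yes; no; contradiction)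
import Relation.Unary as Unary

-- No line is ever traced across the board: all constants come from areas. A line has exactly one
-- first cell and, as gcd(c, d) = 1, its cells are spaced by (c , d); so a board has as many lines
-- as first cells, a difference of two areas. Translation by (c , d) fixes every line, so the lines
-- of the larger board that meet the translate are those of the smaller board, each one cell longer,
-- and every other line is a single new cell. Put A(k) = (k c + r)(k d + n̄) with r = m - c ⌊n/d⌋,
-- which is not negative by the inequality between the floors. At k = 0 the board has height n̄ < d,
-- so each of its A(0) cells is a line of its own, and the first step creates A(1) - 2 A(0) = (d -
-- n̄) r + c (n̄ + d) lines. Every later step creates A(k+1) - 2 A(k) + A(k-1) = 2 c d lines: the
-- staircases come from a constant second difference.

private variable
  A B : Set

-- Elementary symmetric polynomials

[1+_t]*_ : ℕ → Coefficients → Coefficients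
([1+ a t]* f) zero    = f zero
([1+ a t]* f) (suc q) = f (suc q) + a * f q

[1+t]-cong : ∀ a {f g} → f ≗ g → [1+ a t]* f ≗ [1+ a t]* g
[1+t]-cong a f≗g zero    = f≗g zero
[1+t]-cong a f≗g (suc q) = cong₂ (λ x y → x + a * y) (f≗g (suc q)) (f≗g q)

[1+t]-comm : ∀ a b f → [1+ a t]* ([1+ b t]* f) ≗ [1+ b t]* ([1+ a t]* f)
[1+t]-comm a b f zero          = refl
[1+t]-comm a b f (suc zero)    = exchange (f 1) (f 0) a b
  where
  exchange : ∀ x y a b → x + b * y + a * y ≡ x + a * y + b * y
  exchange = solve-∀
[1+t]-comm a b f (suc (suc q)) = exchange (f (suc (suc q))) (f (suc q)) (f q) a b
  where
  exchange : ∀ x y z a b → x + b * y + a * (y + b * z) ≡ x + a * y + b * (y + a * z)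
  exchange = solve-∀

-- The coefficients of ∏ (1 + h t) over the entries h of the list.
esym : List ℕ → Coefficients
esym = foldr [1+_t]*_ 1ₚ

esym-↭ : ∀ {xs ys} → xs ↭ ys → esym xs ≗ esym ys
esym-↭ ↭refl                           q = refl
esym-↭ (prep x p)                      q = [1+t]-cong x (esym-↭ p) q
esym-↭ (swap {xs = xs} {ys = ys} x y p) q =
  trans ([1+t]-comm x y (esym xs) q)
        ([1+t]-cong y ([1+t]-cong x (esym-↭ p)) q)
esym-↭ (↭trans p p′)                   q = trans (esym-↭ p q) (esym-↭ p′ q)

esym-vanishes : ∀ xs {q} → length xs < q → esym xs q ≡ 0
esym-vanishes []       {suc q} _         = refl
esym-vanishes (x ∷ xs) {suc q} (s≤s l<q)
  rewrite esym-vanishes xs (m<n⇒m<1+n l<q) | esym-vanishes xs l<q = *-zeroʳ x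

-- The binomial theorem for (1 + a t)^n, by Pascal's rule.
esym-replicate : ∀ n a q → esym (replicate n a) q ≡ (n C q) * a ^ q
esym-replicate zero    a zero    = refl
esym-replicate zero    a (suc q) = refl
esym-replicate (suc n) a zero    = esym-replicate n a zero
esym-replicate (suc n) a (suc q) = begin
  esym (replicate n a) (suc q) + a * esym (replicate n a) q
    ≡⟨ cong₂ (λ x y → x + a * y) (esym-replicate n a (suc q)) (esym-replicate n a q) ⟩
  (n C suc q) * (a * a ^ q) + a * ((n C q) * a ^ q)
    ≡⟨ collect (n C suc q) (n C q) a (a ^ q) ⟩
  ((n C q) + (n C suc q)) * (a * a ^ q)
    ≡⟨ cong (_* (a * a ^ q)) (nCk+nC[k+1]≡[n+1]C[k+1] n q) ⟩
  (suc n C suc q) * (a * a ^ q) ∎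
  where
  open ≡-Reasoning
  collect : ∀ x y a z → x * (a * z) + a * (y * z) ≡ (y + x) * (a * z)
  collect = solve-∀

sum-map-*ˡ : ∀ k (f : A → ℕ) xs → sum (map (λ x → k * f x) xs) ≡ k * sum (map f xs)
sum-map-*ˡ k f []       = sym (*-zeroʳ k)
sum-map-*ˡ k f (x ∷ xs) =
  trans (cong (λ s → k * f x + s) (sum-map-*ˡ k f xs)) (sym (*-distribˡ-+ k (f x) _))

sum-map-+ : ∀ (f g : A → ℕ) xs →
            sum (map (λ x → f x + g x) xs) ≡ sum (map f xs) + sum (map g xs)
sum-map-+ f g []       = refl
sum-map-+ f g (x ∷ xs) =
  trans (cong (λ s → f x + g x + s) (sum-map-+ f g xs)) (interchange (f x) (g x) _ _)
  where
  interchange : ∀ a b c d → a + b + (c + d) ≡ a + c + (b + d)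
  interchange = solve-∀

sum-map-concatMap : ∀ (f : B → ℕ) (g : A → List B) xs →
                    sum (map f (concatMap g xs)) ≡ sum (map (λ x → sum (map f (g x))) xs)
sum-map-concatMap f g []       = refl
sum-map-concatMap f g (x ∷ xs) =
  trans (cong sum (map-++ f (g x) _))
  (trans (sum-++ (map f (g x)) _)
         (cong (sum (map f (g x)) +_) (sum-map-concatMap f g xs)))

-- Splits the summand i = 0 off the Cauchy product; what remains is a Cauchy product again, with the
-- first factor shifted down, so identities for `*ₚ` can be proved by induction on the degree.
*ₚ-suc : ∀ f g q → (f *ₚ g) (suc q) ≡ f 0 * g (suc q) + ((f ∘ suc) *ₚ g) q
*ₚ-suc f g q = cong (λ s → f 0 * g (suc q) + sum s)
  (trans (map-applyUpTo suc _ (suc q)) (sym (map-applyUpTo id _ (suc q))))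

1ₚ-*ₚ : ∀ g → 1ₚ *ₚ g ≗ g
1ₚ-*ₚ g zero    = trans (+-identityʳ _) (+-identityʳ _)
1ₚ-*ₚ g (suc q) = begin
  (1ₚ *ₚ g) (suc q)                          ≡⟨ *ₚ-suc 1ₚ g q ⟩
  1 * g (suc q) + ((1ₚ ∘ suc) *ₚ g) q        ≡⟨ cong₂ _+_ (+-identityʳ _) (sum-map-*ˡ 0 (λ _ → 0) (upTo (suc q))) ⟩
  g (suc q) + 0                              ≡⟨ +-identityʳ _ ⟩
  g (suc q)                                  ∎
  where open ≡-Reasoning

-- The instance of associativity that lets `esym-++` pull out one linear factor at a time.
[1+t]-*ₚ : ∀ a f g → ([1+ a t]* f) *ₚ g ≗ [1+ a t]* (f *ₚ g)
[1+t]-*ₚ a f g zero    = refl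
[1+t]-*ₚ a f g (suc q) = begin
  (([1+ a t]* f) *ₚ g) (suc q)
    ≡⟨ *ₚ-suc ([1+ a t]* f) g q ⟩
  f 0 * g (suc q) + sum (map (λ i → (f (suc i) + a * f i) * g (q ∸ i)) (upTo (suc q)))
    ≡⟨ cong (λ s → f 0 * g (suc q) + sum s) (map-cong (λ i → expand (f (suc i)) a (f i) (g (q ∸ i))) (upTo (suc q))) ⟩
  f 0 * g (suc q) + sum (map (λ i → f (suc i) * g (q ∸ i) + a * (f i * g (q ∸ i))) (upTo (suc q)))
    ≡⟨ cong (f 0 * g (suc q) +_) (sum-map-+ (λ i → f (suc i) * g (q ∸ i)) _ (upTo (suc q))) ⟩
  f 0 * g (suc q) + (((f ∘ suc) *ₚ g) q + sum (map (λ i → a * (f i * g (q ∸ i))) (upTo (suc q))))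
    ≡⟨ cong (λ s → f 0 * g (suc q) + (((f ∘ suc) *ₚ g) q + s)) (sum-map-*ˡ a _ (upTo (suc q))) ⟩
  f 0 * g (suc q) + (((f ∘ suc) *ₚ g) q + a * (f *ₚ g) q)
    ≡⟨ +-assoc (f 0 * g (suc q)) _ _ ⟨
  f 0 * g (suc q) + ((f ∘ suc) *ₚ g) q + a * (f *ₚ g) q
    ≡⟨ cong (_+ a * (f *ₚ g) q) (*ₚ-suc f g q) ⟨
  (f *ₚ g) (suc q) + a * (f *ₚ g) q ∎
  where
  open ≡-Reasoning
  expand : ∀ x a y z → (x + a * y) * z ≡ x * z + a * (y * z)
  expand = solve-∀

esym-++ : ∀ xs ys → esym (xs ++ ys) ≗ esym xs *ₚ esym ys
esym-++ []       ys q = sym (1ₚ-*ₚ (esym ys) q)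
esym-++ (x ∷ xs) ys q =
  trans ([1+t]-cong x (esym-++ xs ys) q) (sym ([1+t]-*ₚ x (esym xs) (esym ys) q))

esymProduct : ∀ {l} → Vec (List ℕ) l → Vec ℕ l → ℕ
esymProduct []       []       = 1
esymProduct (h ∷ hs) (x ∷ xs) = esym h x * esymProduct hs xs

-- A tuple records how many of the q chosen lines come from each block. Summing over its first entry
-- is one Cauchy product, so the whole sum is a coefficient of the product of all blocks.
sum-esymProduct : ∀ {l} (hs : Vec (List ℕ) l) q →
                  sum (map (esymProduct hs) (tuplesWithSum l q)) ≡ esym (concat (Vec.toList hs)) q
sum-esymProduct []       zero    = refl
sum-esymProduct []       (suc q) = refl
sum-esymProduct {suc l} (h ∷ hs) q = begin
  sum (map (esymProduct (h ∷ hs)) (concatMap (λ a → map (a ∷_) (tuplesWithSum l (q ∸ a))) (upTo (suc q))))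
    ≡⟨ sum-map-concatMap (esymProduct (h ∷ hs)) (λ a → map (a ∷_) (tuplesWithSum l (q ∸ a))) (upTo (suc q)) ⟩
  sum (map (λ a → sum (map (esymProduct (h ∷ hs)) (map (a ∷_) (tuplesWithSum l (q ∸ a))))) (upTo (suc q)))
    ≡⟨ cong sum (map-cong firstEntry (upTo (suc q))) ⟩
  (esym h *ₚ esym (concat (Vec.toList hs))) q
    ≡⟨ esym-++ h (concat (Vec.toList hs)) q ⟨
  esym (h ++ concat (Vec.toList hs)) q ∎
  where
  open ≡-Reasoning
  firstEntry : ∀ a → sum (map (esymProduct (h ∷ hs)) (map (a ∷_) (tuplesWithSum l (q ∸ a))))
                   ≡ esym h a * esym (concat (Vec.toList hs)) (q ∸ a)
  firstEntry a =
    trans (cong sum (sym (map-∘ (tuplesWithSum l (q ∸ a)))))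
    (trans (sum-map-*ˡ (esym h a) (esymProduct hs) (tuplesWithSum l (q ∸ a)))
           (cong (esym h a *_) (sum-esymProduct hs (q ∸ a))))

-- Stirling numbers as elementary symmetric polynomials

1…_ : ℕ → List ℕ
1… n = applyUpTo suc n

risingFactorial-suc-0 : ∀ N → risingFactorial (suc N) 0 ≡ 0
risingFactorial-suc-0 zero    = refl
risingFactorial-suc-0 (suc N) =
  trans (+-identityʳ _) (cong (_* suc N) (risingFactorial-suc-0 N))

-- For f = `risingFactorial N` and a = N this is the recurrence of the Stirling numbers.
*ₚ-x+ : ∀ f a q → (f *ₚ (x+ a)) (suc q) ≡ a * f (suc q) + f q
*ₚ-x+ f a zero    = simplify (f 0) (f 1) a
  where
  simplify : ∀ x y a → x * 1 + (y * a + 0) ≡ a * y + x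
  simplify = solve-∀
*ₚ-x+ f a (suc q) = begin
  (f *ₚ (x+ a)) (suc (suc q))                ≡⟨ *ₚ-suc f (x+ a) (suc q) ⟩
  f 0 * 0 + ((f ∘ suc) *ₚ (x+ a)) (suc q)    ≡⟨ cong₂ _+_ (*-zeroʳ (f 0)) (*ₚ-x+ (f ∘ suc) a q) ⟩
  a * f (suc (suc q)) + f (suc q)            ∎
  where open ≡-Reasoning

risingFactorial-vanishes : ∀ N {r} → N < r → risingFactorial N r ≡ 0
risingFactorial-vanishes zero    {suc r} _         = refl
risingFactorial-vanishes (suc N) {suc r} (s≤s N<r) = begin
  risingFactorial (suc N) (suc r)                       ≡⟨ *ₚ-x+ (risingFactorial N) N r ⟩
  N * risingFactorial N (suc r) + risingFactorial N r   ≡⟨ cong₂ (λ x y → N * x + y) (risingFactorial-vanishes N (m<n⇒m<1+n N<r)) (risingFactorial-vanishes N N<r) ⟩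
  N * 0 + 0                                             ≡⟨ cong (_+ 0) (*-zeroʳ N) ⟩
  0                                                     ∎
  where open ≡-Reasoning

-- Reversing the coefficients of X (X + 1) ⋯ (X + N) turns each factor X + i into 1 + i t, and the
-- factor X into 1. The relation between r and x is stated additively to avoid truncated
-- subtraction.
risingFactorial≡esym : ∀ N r x → r + x ≡ suc N → risingFactorial (suc N) r ≡ esym (1… N) x
risingFactorial≡esym N zero x refl =
  trans (risingFactorial-suc-0 N)
        (sym (esym-vanishes (1… N) (s≤s (≤-reflexive (length-applyUpTo suc N)))))
risingFactorial≡esym zero (suc r) x r+x≡0
  rewrite m+n≡0⇒m≡0 r (suc-injective r+x≡0) | m+n≡0⇒n≡0 r (suc-injective r+x≡0) = refl
risingFactorial≡esym (suc N) (suc r) x r+x≡N = begin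
  risingFactorial (suc (suc N)) (suc r)
    ≡⟨ *ₚ-x+ (risingFactorial (suc N)) (suc N) r ⟩
  suc N * risingFactorial (suc N) (suc r) + risingFactorial (suc N) r
    ≡⟨ lastFactor x r+x≡N ⟩
  esym (suc N ∷ 1… N) x
    ≡⟨ esym-↭ (↭-trans (∷↭∷ʳ (suc N) (1… N)) (↭-reflexive (applyUpTo-∷ʳ suc N))) x ⟩
  esym (1… (suc N)) x ∎
  where
  open ≡-Reasoning
  lastFactor : ∀ x → suc r + x ≡ suc (suc N) →
               suc N * risingFactorial (suc N) (suc r) + risingFactorial (suc N) r
               ≡ esym (suc N ∷ 1… N) x
  -- Here `suc r` is `suc (suc N)`, beyond the degree of the rising factorial, so only the second
  -- summand survives.
  lastFactor zero r+0≡N = cong₂ _+_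
    (trans (cong (suc N *_) (risingFactorial-vanishes (suc N)
             (≤-reflexive (sym (trans (sym (+-identityʳ _)) r+0≡N)))))
           (*-zeroʳ (suc N)))
    (risingFactorial≡esym N r 0 (suc-injective r+0≡N))
  lastFactor (suc x) r+x≡N = trans (+-comm _ (risingFactorial (suc N) r)) (cong₂ _+_
    (risingFactorial≡esym N r (suc x) (suc-injective r+x≡N))
    (cong (suc N *_) (risingFactorial≡esym N (suc r) x
      (trans (sym (+-suc r x)) (suc-injective r+x≡N)))))

-- A negative lower index means x > N + 1, more factors than the list has entries, so both sides are
-- 0.
stirling₁≡esym : ∀ N x → stirling₁ (suc N) (suc N ⊖ x) ≡ esym (1… N) x
stirling₁≡esym N x with x ≤? suc N
... | yes x≤N rewrite ℤ.⊖-≥ x≤N = risingFactorial≡esym N (suc N ∸ x) x (m∸n+n≡m x≤N)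
... | no  x≰N rewrite ℤ.⊖-< (≰⇒> x≰N) with x ∸ suc N in eq
...   | zero  = contradiction (m∸n≡0⇒m≤n eq) x≰N
...   | suc _ = sym (esym-vanishes (1… N)
                  (≤-trans (s≤s (≤-reflexive (length-applyUpTo suc N)))
                           (≤-trans (n≤1+n (suc N)) (≰⇒> x≰N))))

-- Subsets with distinct colours

Unique-resp-↭ : ∀ {xs ys : List A} → xs ↭ ys → Unique xs → Unique ys
Unique-resp-↭ p = SetoidPerm.Unique-resp-↭ (setoid _) (↭⇒↭ₛ p)

∈⇒∃↭∷ : ∀ {x : A} {xs} → x ∈ xs → ∃ λ ys → xs ↭ x ∷ ys
∈⇒∃↭∷ x∈xs with ys , zs , refl ← ∈-∃++ x∈xs = ys ++ zs , shift _ ys zs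

Unique-++⇒disjoint : ∀ {xs ys : List A} → Unique (xs ++ ys) → ∀ {x} → x ∈ xs → x ∉ ys
Unique-++⇒disjoint {xs = _ ∷ xs} (x∉ ∷ _) (Any.here refl) x∈ys =
  All.lookup x∉ (∈-++⁺ʳ xs x∈ys) refl
Unique-++⇒disjoint (_ ∷ xs!) (Any.there x∈xs) = Unique-++⇒disjoint xs! x∈xs

Unique-++⁻ʳ : ∀ (xs {ys} : List A) → Unique (xs ++ ys) → Unique ys
Unique-++⁻ʳ []       ys!       = ys!
Unique-++⁻ʳ (x ∷ xs) (_ ∷ xs!) = Unique-++⁻ʳ xs xs!

complement : ∀ {ys xs : List A} → Unique ys → (∀ {x} → x ∈ ys → x ∈ xs) → ∃ λ zs → xs ↭ ys ++ zs
complement {xs = xs} [] _ = xs , ↭-refl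
complement {ys = y ∷ ys} {xs} (y∉ys ∷ ys!) ys⊆xs
  with xs′ , xs↭ ← ∈⇒∃↭∷ (ys⊆xs (Any.here refl))
  with zs , xs′↭ ← complement ys! (λ x∈ys →
      Any.tail (λ { refl → All.lookup y∉ys x∈ys refl }) (∈-resp-↭ xs↭ (ys⊆xs (Any.there x∈ys))))
  = zs , ↭-trans xs↭ (prep y xs′↭)

-- Injectivity is required on the members only: `line` identifies cells in general, but not the
-- first cells of lines.
Unique-map⁺ : ∀ (f : A → B) {xs} → (∀ {x y} → x ∈ xs → y ∈ xs → f x ≡ f y → x ≡ y) →
              Unique xs → Unique (map f xs)
Unique-map⁺ f inj []          = []
Unique-map⁺ f inj (x∉xs ∷ xs!) =
  All.map⁺ (All.tabulate λ y∈xs fx≡fy →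
    All.lookup x∉xs y∈xs (inj (Any.here refl) (Any.there y∈xs) fx≡fy))
  ∷ Unique-map⁺ f (λ x∈ y∈ → inj (Any.there x∈) (Any.there y∈)) xs!

length-filter-map : ∀ {P : B → Set} (P? : Unary.Decidable P) (f : A → B) xs →
                    length (filter P? (map f xs)) ≡ length (filter (P? ∘ f) xs)
length-filter-map P? f []       = refl
length-filter-map P? f (x ∷ xs) with P? (f x)
... | yes _ = cong suc (length-filter-map P? f xs)
... | no  _ = length-filter-map P? f xs

length-filter-none : ∀ {P : A → Set} (P? : Unary.Decidable P) xs → (∀ x → ¬ P x) →
                     length (filter P? xs) ≡ 0
length-filter-none P? xs ¬P =
  cong length (filter-none P? (All.universal ¬P xs))

-- `U` lists the colours still available. It makes the notion inductive: once a cell is chosen, its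
-- colour is struck from `U`.
Rainbow : ∀ {K} → (Fin K → A) → List A → ℕ → Subset K → Set
Rainbow f U q S =
  ∣ S ∣ ≡ q × (∀ s → s ∈ₛ S → f s ∈ U) × (∀ s t → s ∈ₛ S → t ∈ₛ S → f s ≡ f t → s ≡ t)

module _ {K} (f : Fin (suc K) → A) where

  rainbow-outside : ∀ {U q S} → Rainbow f U q (outside ∷ S) ⇔ Rainbow (f ∘ suc) U q S
  rainbow-outside {U} {q} {S} = mk⇔ to from
    where
    to : Rainbow f U q (outside ∷ S) → Rainbow (f ∘ suc) U q S
    to (size , col , inj) =
      size , (λ s s∈ → col (suc s) (there s∈)) ,
      λ s t s∈ t∈ eq → Fin.suc-injective (inj _ _ (there s∈) (there t∈) eq)
    from : Rainbow (f ∘ suc) U q S → Rainbow f U q (outside ∷ S)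
    from (size , col , inj) =
      size , (λ { (suc s) (there s∈) → col s s∈ }) ,
      λ { (suc s) (suc t) (there s∈) (there t∈) eq → cong suc (inj s t s∈ t∈ eq) }

  rainbow-inside : ∀ {U V q S} → U ↭ f zero ∷ V → Unique (f zero ∷ V) →
                   Rainbow f U (suc q) (inside ∷ S) ⇔ Rainbow (f ∘ suc) V q S
  rainbow-inside {U} {V} {q} {S} U↭ (f₀∉V ∷ _) = mk⇔ to from
    where
    to : Rainbow f U (suc q) (inside ∷ S) → Rainbow (f ∘ suc) V q S
    to (size , col , inj) =
      suc-injective size , (λ s s∈ → otherColour s s∈ (∈-resp-↭ U↭ (col (suc s) (there s∈)))) ,
      λ s t s∈ t∈ eq → Fin.suc-injective (inj _ _ (there s∈) (there t∈) eq)
      where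
      otherColour : ∀ s → s ∈ₛ S → f (suc s) ∈ f zero ∷ V → f (suc s) ∈ V
      otherColour s s∈ (Any.here eq) with () ← inj (suc s) zero (there s∈) here eq
      otherColour s s∈ (Any.there p) = p
    from : Rainbow (f ∘ suc) V q S → Rainbow f U (suc q) (inside ∷ S)
    from (size , col , inj) = cong suc size , col′ , inj′
      where
      col′ : ∀ s → s ∈ₛ inside ∷ S → f s ∈ U
      col′ zero    _          = ∈-resp-↭ (↭-sym U↭) (Any.here refl)
      col′ (suc s) (there s∈) = ∈-resp-↭ (↭-sym U↭) (Any.there (col s s∈))
      inj′ : ∀ s t → s ∈ₛ inside ∷ S → t ∈ₛ inside ∷ S → f s ≡ f t → s ≡ t
      inj′ zero    zero    _          _          _  = refl
      inj′ zero    (suc t) _          (there t∈) eq = contradiction eq (All.lookup f₀∉V (col t t∈))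
      inj′ (suc s) zero    (there s∈) _          eq = contradiction (sym eq) (All.lookup f₀∉V (col s s∈))
      inj′ (suc s) (suc t) (there s∈) (there t∈) eq = cong suc (inj s t s∈ t∈ eq)

-- The case without cells, where every available colour has multiplicity 0.
esym-zeros : ∀ {U : List A} → esym (map (λ _ → 0) U) ≗ 1ₚ
esym-zeros {U = []}    q       = refl
esym-zeros {U = _ ∷ U} zero    = esym-zeros {U = U} 0
esym-zeros {U = _ ∷ U} (suc q) = trans (+-identityʳ _) (esym-zeros {U = U} (suc q))

module Counting (_≟_ : DecidableEquality A) where

  open DecMembership _≟_ using (_∈?_)

  count : List A → A → ℕ
  count xs u = length (filter (u ≟_) xs)

  count-↭ : ∀ {xs ys} → xs ↭ ys → count xs ≗ count ys
  count-↭ p u = ↭-length (filter-↭ (u ≟_) p)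

  count-++ : ∀ xs ys u → count (xs ++ ys) u ≡ count xs u + count ys u
  count-++ xs ys u = trans (cong length (filter-++ (u ≟_) xs ys)) (length-++ (filter (u ≟_) xs))

  count-∷-≡ : ∀ u xs → count (u ∷ xs) u ≡ suc (count xs u)
  count-∷-≡ u xs with u ≟ u
  ... | yes _ = refl
  ... | no ≢  = contradiction refl ≢

  count-∷-≢ : ∀ {u x} xs → u ≢ x → count (x ∷ xs) u ≡ count xs u
  count-∷-≢ {u} {x} xs u≢x with u ≟ x
  ... | yes eq = contradiction eq u≢x
  ... | no _   = refl

  map-count-∷ : ∀ {x U} xs → x ∉ U → map (count (x ∷ xs)) U ≡ map (count xs) U
  map-count-∷ xs x∉U = map-cong-local
    (All.tabulate λ {u} u∈U → count-∷-≢ xs λ { refl → x∉U u∈U })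

  count-∉ : ∀ {u xs} → u ∉ xs → count xs u ≡ 0
  count-∉ {xs = []}     _  = refl
  count-∉ {xs = x ∷ xs} u∉ =
    trans (count-∷-≢ xs (u∉ ∘ Any.here)) (count-∉ (u∉ ∘ Any.there))

  count-Unique-∈ : ∀ {u xs} → Unique xs → u ∈ xs → count xs u ≡ 1
  count-Unique-∈ {xs = x ∷ xs} (x∉xs ∷ _) (Any.here refl) =
    trans (count-∷-≡ x xs) (cong suc (count-∉ (λ x∈ → All.lookup x∉xs x∈ refl)))
  count-Unique-∈ {xs = x ∷ xs} (x∉xs ∷ xs!) (Any.there u∈) =
    trans (count-∷-≢ xs (λ { refl → All.lookup x∉xs u∈ refl })) (count-Unique-∈ xs! u∈)

  count-rainbow : ∀ {K} (f : Fin K → A) {U} → Unique U → ∀ q {P : Subset K → Set}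
                  (P? : Unary.Decidable P) → (∀ S → P S ⇔ Rainbow f U q S) →
                  length (filter P? (allSubsets K)) ≡ esym (map (count (tabulate f)) U) q
  count-rainbow {zero} f {U} U! q {P} P? P⇔ = trans (only-[] q P⇔) (sym (esym-zeros {U = U} q))
    where
    only-[] : ∀ q → (∀ S → P S ⇔ Rainbow f U q S) → length (filter P? ([] ∷ [])) ≡ 1ₚ q
    only-[] q P⇔ with P? []
    only-[] zero    P⇔ | yes _ = refl
    only-[] zero    P⇔ | no ¬p = contradiction (Equivalence.from (P⇔ []) (refl , (λ ()) , (λ ()))) ¬p
    only-[] (suc q) P⇔ | yes p with () ← proj₁ (Equivalence.to (P⇔ []) p)
    only-[] (suc q) P⇔ | no _  = refl
  count-rainbow {suc K} f {U} U! q {P} P? P⇔ = begin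
    length (filter P? (map (outside ∷_) (allSubsets K) ++ map (inside ∷_) (allSubsets K)))
      ≡⟨ cong length (filter-++ P? (map (outside ∷_) (allSubsets K)) _) ⟩
    length (filter P? (map (outside ∷_) (allSubsets K)) ++ filter P? (map (inside ∷_) (allSubsets K)))
      ≡⟨ length-++ (filter P? (map (outside ∷_) (allSubsets K))) ⟩
    length (filter P? (map (outside ∷_) (allSubsets K))) + length (filter P? (map (inside ∷_) (allSubsets K)))
      ≡⟨ cong₂ _+_ (length-filter-map P? _ (allSubsets K)) (length-filter-map P? _ (allSubsets K)) ⟩
    length (filter (P? ∘ (outside ∷_)) (allSubsets K)) + length (filter (P? ∘ (inside ∷_)) (allSubsets K))
      ≡⟨ cong (_+ length (filter (P? ∘ (inside ∷_)) (allSubsets K)))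
           (count-rainbow (f ∘ suc) U! q (P? ∘ (outside ∷_)) λ S → rainbow-outside f ⇔-∘ P⇔ (outside ∷ S)) ⟩
    esym (map (count xs) U) q + length (filter (P? ∘ (inside ∷_)) (allSubsets K))
      ≡⟨ byColour q P⇔ (f zero ∈? U) ⟩
    esym (map (count (f zero ∷ xs)) U) q ∎
    where
    open ≡-Reasoning
    xs = tabulate (f ∘ suc)

    byColour : ∀ q → (∀ S → P S ⇔ Rainbow f U q S) → Dec (f zero ∈ U) →
               esym (map (count xs) U) q + length (filter (P? ∘ (inside ∷_)) (allSubsets K))
               ≡ esym (map (count (f zero ∷ xs)) U) q
    byColour q P⇔ (no f₀∉U) = begin
      esym (map (count xs) U) q + length (filter (P? ∘ (inside ∷_)) (allSubsets K))
        ≡⟨ cong (esym (map (count xs) U) q +_) (length-filter-none _ (allSubsets K)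
             λ S p → f₀∉U (proj₁ (proj₂ (Equivalence.to (P⇔ (inside ∷ S)) p)) zero here)) ⟩
      esym (map (count xs) U) q + 0
        ≡⟨ +-identityʳ _ ⟩
      esym (map (count xs) U) q
        ≡⟨ cong (λ hs → esym hs q) (map-count-∷ xs f₀∉U) ⟨
      esym (map (count (f zero ∷ xs)) U) q ∎
    byColour q P⇔ (yes f₀∈U) with V , U↭ ← ∈⇒∃↭∷ f₀∈U with Unique-resp-↭ U↭ U!
    ... | W!@(f₀∉V ∷ V!) = begin
      esym (map (count xs) U) q + length (filter (P? ∘ (inside ∷_)) (allSubsets K))
        ≡⟨ cong (_+ length (filter (P? ∘ (inside ∷_)) (allSubsets K))) (esym-↭ (map⁺ (count xs) U↭) q) ⟩
      esym (count xs (f zero) ∷ map (count xs) V) q + length (filter (P? ∘ (inside ∷_)) (allSubsets K))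
        ≡⟨ bySize q P⇔ ⟩
      esym (suc (count xs (f zero)) ∷ map (count xs) V) q
        ≡⟨ cong (λ hs → esym hs q) (cong₂ _∷_ (count-∷-≡ (f zero) xs) 
             (map-count-∷ xs λ f₀∈V → All.lookup f₀∉V f₀∈V refl)) ⟨
      esym (map (count (f zero ∷ xs)) (f zero ∷ V)) q
        ≡⟨ esym-↭ (map⁺ (count (f zero ∷ xs)) U↭) q ⟨
      esym (map (count (f zero ∷ xs)) U) q ∎
      where
      bySize : ∀ q → (∀ S → P S ⇔ Rainbow f U q S) →
               esym (count xs (f zero) ∷ map (count xs) V) q + length (filter (P? ∘ (inside ∷_)) (allSubsets K))
               ≡ esym (suc (count xs (f zero)) ∷ map (count xs) V) q
      bySize zero P⇔ = trans (cong (esym (map (count xs) V) 0 +_)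
        (length-filter-none _ (allSubsets K) λ S p → nonempty (proj₁ (Equivalence.to (P⇔ (inside ∷ S)) p))))
        (+-identityʳ _)
        where
        nonempty : ∀ {n} → suc n ≢ 0
        nonempty ()
      -- With E the product over the other colours, (1 + (h + 1) t) E = (1 + h t) E + t E; the last
      -- term accounts for the subsets containing cell zero.
      bySize (suc q) P⇔ = trans
        (cong (esym (count xs (f zero) ∷ map (count xs) V) (suc q) +_)
          (count-rainbow (f ∘ suc) V! q (P? ∘ (inside ∷_)) λ S → rainbow-inside f U↭ W! ⇔-∘ P⇔ (inside ∷ S)))
        (trans (+-assoc (esym (map (count xs) V) (suc q)) _ _)
               (cong (esym (map (count xs) V) (suc q) +_) (+-comm _ (esym (map (count xs) V) q))))

  -- Determines `hs` only up to order, which is all that `esym` sees; the order of `values` stays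
  -- free.
  record Multiplicities (xs : List A) (hs : List ℕ) : Set where
    field
      values  : List A
      unique  : Unique values
      sound   : ∀ {x} → x ∈ values → x ∈ xs
      covers  : ∀ {x} → x ∈ xs → x ∈ values
      counted : map (count xs) values ↭ hs

  multiplicities-Unique : ∀ {xs} → Unique xs → Multiplicities xs (replicate (length xs) 1)
  multiplicities-Unique {xs} xs! = record
    { values  = xs
    ; unique  = xs!
    ; sound   = id
    ; covers  = id
    ; counted = ↭-reflexive (trans
        (map-cong-local (All.tabulate (count-Unique-∈ xs!)))
        (map-const xs))
    }
    where
    map-const : ∀ (xs : List A) → map (λ _ → 1) xs ≡ replicate (length xs) 1
    map-const []       = refl
    map-const (_ ∷ xs) = cong (1 ∷_) (map-const xs)

  -- `U` holds each value of `xs` exactly once, so appending it to `ys` raises every old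
  -- multiplicity by one and gives each new value multiplicity 1. The old values number `length hs`,
  -- which leaves e new ones.
  multiplicities-++ : ∀ {xs ys U hs e} → Multiplicities ys hs → xs ↭ ys ++ U → Unique U →
                      (∀ {x} → x ∈ xs → x ∈ U) → length U ≡ e + length hs →
                      Multiplicities xs (replicate e 1 ++ map suc hs)
  multiplicities-++ {xs} {ys} {U} {hs} {e} M xs↭ U! xs⊆U ∣U∣ = record
    { values  = U
    ; unique  = U!
    ; sound   = λ x∈U → ∈-resp-↭ (↭-sym xs↭) (∈-++⁺ʳ ys x∈U)
    ; covers  = xs⊆U
    ; counted = splitNew (complement unique
        (λ x∈ → xs⊆U (∈-resp-↭ (↭-sym xs↭) (∈-++⁺ˡ (sound x∈)))))
    }
    where
    open Multiplicities M

    length-values : length values ≡ length hs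
    length-values = trans (sym (length-map _ values)) (↭-length counted)

    splitNew : (∃ λ new → U ↭ values ++ new) → map (count xs) U ↭ replicate e 1 ++ map suc hs
    splitNew (new , U↭) =
      ↭-trans (↭-reflexive (map-cong-local (All.tabulate raised)))
      (↭-trans (map⁺ (suc ∘ count ys) U↭)
      (↭-trans (↭-trans (↭-reflexive (map-++ (suc ∘ count ys) values new)) (++-comm (map (suc ∘ count ys) values) _))
      (++⁺ (↭-reflexive (trans (ones new fresh) (cong (λ k → replicate k 1) length-new)))
           (↭-trans (↭-reflexive (map-∘ values)) (map⁺ suc counted)))))
      where
      raised : ∀ {u} → u ∈ U → count xs u ≡ suc (count ys u)
      raised {u} u∈U = trans (count-↭ xs↭ u) (trans (count-++ ys U u)
        (trans (cong (count ys u +_) (count-Unique-∈ U! u∈U)) (+-comm _ 1)))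


      fresh : ∀ {u} → u ∈ new → count ys u ≡ 0
      fresh u∈new = count-∉ λ u∈ys →
        Unique-++⇒disjoint (Unique-resp-↭ U↭ U!) (covers u∈ys) u∈new

      ones : ∀ us → (∀ {u} → u ∈ us → count ys u ≡ 0) →
             map (suc ∘ count ys) us ≡ replicate (length us) 1
      ones []       _     = refl
      ones (u ∷ us) fresh = cong₂ _∷_ (cong suc (fresh (Any.here refl))) (ones us (fresh ∘ Any.there))

      length-new : length new ≡ e
      length-new = +-cancelʳ-≡ (length hs) (length new) e (trans (+-comm (length new) _)
        (trans (cong (_+ length new) (sym length-values))
        (trans (sym (length-++ values)) (trans (sym (↭-length U↭)) ∣U∣))))

-- Lines on the board

⊖≡⊖⇒+≡+ : ∀ {a b a′ b′} → a ⊖ b ≡ a′ ⊖ b′ → a + b′ ≡ a′ + b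
⊖≡⊖⇒+≡+ {a} {b} {a′} {b′} eq = ℤ.+-injective (begin
  ℤ.+ (a + b′)                  ≡⟨ cancel a b b′ ⟨
  a ⊖ b ℤ.+ ℤ.+ (b + b′)        ≡⟨ cong₂ (λ x k → x ℤ.+ ℤ.+ k) eq (+-comm b b′) ⟩
  a′ ⊖ b′ ℤ.+ ℤ.+ (b′ + b)      ≡⟨ cancel a′ b′ b ⟩
  ℤ.+ (a′ + b)                  ∎)
  where
  open ≡-Reasoning
  exchange : ∀ a b k → a + (b + k) ≡ b + (a + k)
  exchange = solve-∀
  cancel : ∀ a b k → a ⊖ b ℤ.+ ℤ.+ (b + k) ≡ ℤ.+ (a + k)
  cancel a b k = trans (ℤ.distribˡ-⊖-+-pos (b + k) a b)
    (trans (cong₂ _⊖_ (exchange a b k) (sym (+-identityʳ b))) (ℤ.+-cancelˡ-⊖ b (a + k) 0))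

tabulate-+ : ∀ m {n} (f : Fin (m + n) → A) →
             tabulate f ≡ tabulate (f ∘ (_↑ˡ n)) ++ tabulate (f ∘ (m ↑ʳ_))
tabulate-+ zero    f = refl
tabulate-+ (suc m) f = cong (f zero ∷_) (tabulate-+ m (f ∘ suc))

tabulate-toℕ : ∀ (f : ℕ → A) n → tabulate {n = n} (f ∘ toℕ) ≡ applyUpTo f n
tabulate-toℕ f zero    = refl
tabulate-toℕ f (suc n) = cong (f 0 ∷_) (tabulate-toℕ (f ∘ suc) n)

Cell : Set
Cell = ℕ × ℕ

cell : ∀ m n → Fin (m * n) → Cell
cell m n s = let (i , j) = remQuot {m} n s in (toℕ i , toℕ j)

cell-injective : ∀ m n {s t} → cell m n s ≡ cell m n t → s ≡ t
cell-injective m n {s} {t} eq = begin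
  s                                         ≡⟨ Fin.combine-remQuot {m} n s ⟨
  uncurry combine (remQuot {m} n s) ≡⟨ cong (uncurry combine) (cong₂ _,_
                                                 (Fin.toℕ-injective (cong proj₁ eq))
                                                 (Fin.toℕ-injective (cong proj₂ eq))) ⟩
  uncurry combine (remQuot {m} n t) ≡⟨ Fin.combine-remQuot {m} n t ⟩
  t                                         ∎
  where open ≡-Reasoning

cells : ℕ → ℕ → List Cell
cells m n = cartesianProduct (upTo m) (upTo n)

-- The function g is there for the induction on m: past the first block, the first coordinates start
-- at 1 instead of 0.
tabulate-remQuot : ∀ m n (g : ℕ → ℕ) (h : Cell → A) →
  tabulate (λ s → let (i , j) = remQuot {m} n s in h (g (toℕ i) , toℕ j))
  ≡ map h (cartesianProduct (applyUpTo g m) (upTo n))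
tabulate-remQuot zero    n g h = refl
tabulate-remQuot (suc m) n g h = begin
  tabulate F
    ≡⟨ tabulate-+ n F ⟩
  tabulate (F ∘ (_↑ˡ m * n)) ++ tabulate (F ∘ (n ↑ʳ_))
    ≡⟨ cong₂ _++_ (tabulate-cong firstRow) (tabulate-cong otherRows) ⟩
  tabulate ((λ j → h (g 0 , j)) ∘ toℕ) ++
  tabulate (λ s → let (i , j) = remQuot {m} n s in h (g (suc (toℕ i)) , toℕ j))
    ≡⟨ cong₂ _++_ row (tabulate-remQuot m n (g ∘ suc) h) ⟩
  map h (map (g 0 ,_) (upTo n)) ++ map h (cartesianProduct (applyUpTo (g ∘ suc) m) (upTo n))
    ≡⟨ map-++ h (map (g 0 ,_) (upTo n)) _ ⟨
  map h (cartesianProduct (applyUpTo g (suc m)) (upTo n)) ∎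
  where
  open ≡-Reasoning
  F = λ s → let (i , j) = remQuot {suc m} n s in h (g (toℕ i) , toℕ j)
  firstRow : ∀ j → F (j ↑ˡ m * n) ≡ h (g 0 , toℕ j)
  firstRow j rewrite Fin.splitAt-↑ˡ n j (m * n) = refl
  otherRows : ∀ s → F (n ↑ʳ s) ≡ (let (i , j) = remQuot {m} n s in h (g (suc (toℕ i)) , toℕ j))
  otherRows s rewrite Fin.splitAt-↑ʳ n (m * n) s = refl
  row : tabulate ((λ j → h (g 0 , j)) ∘ toℕ) ≡ map h (map (g 0 ,_) (upTo n))
  row = trans (tabulate-toℕ (λ j → h (g 0 , j)) n)
        (trans (sym (map-applyUpTo id _ n)) (map-∘ (upTo n)))

∈-cells⁺ : ∀ {m n i j} → i < m → j < n → (i , j) ∈ cells m n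
∈-cells⁺ i<m j<n = ∈-cartesianProduct⁺ (∈-upTo⁺ i<m) (∈-upTo⁺ j<n)

∈-cells⁻ : ∀ m n {i j} → (i , j) ∈ cells m n → i < m × j < n
∈-cells⁻ m n ij∈ with i∈ , j∈ ← ∈-cartesianProduct⁻ (upTo m) (upTo n) ij∈ = ∈-upTo⁻ i∈ , ∈-upTo⁻ j∈

cells-Unique : ∀ m n → Unique (cells m n)
cells-Unique m n = Unique.cartesianProduct⁺ (Unique.upTo⁺ m) (Unique.upTo⁺ n)

length-cartesianProduct : ∀ (xs : List A) (ys : List B) →
                          length (cartesianProduct xs ys) ≡ length xs * length ys
length-cartesianProduct []       ys = refl
length-cartesianProduct (x ∷ xs) ys = trans (length-++ (map (x ,_) ys))
  (cong₂ _+_ (length-map (x ,_) ys) (length-cartesianProduct xs ys))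

length-cells : ∀ m n → length (cells m n) ≡ m * n
length-cells m n = trans (length-cartesianProduct (upTo m) (upTo n)) (cong₂ _*_ (length-upTo m) (length-upTo n))

attacks-sym : ∀ {M z w} → Attacks M z w → Attacks M w z
attacks-sym {M@(c , d)} {z@(x , y)} (k , k≢0 , w≡) =
  ℤ.- k , (λ -k≡0 → k≢0 (ℤ.neg-injective -k≡0)) ,
  subst (λ w → z ≡ w +[ ℤ.- k ] M) (sym w≡) (cong₂ _,_ (undo x c) (undo y d))
  where
  undo : ∀ x c → x ≡ (x ℤ.+ k ℤ.* ℤ.+ c) ℤ.+ (ℤ.- k) ℤ.* ℤ.+ c
  undo x c = sym (trans (ℤ.+-assoc x _ _)
    (trans (cong (λ e → x ℤ.+ (k ℤ.* ℤ.+ c ℤ.+ e)) (sym (ℤ.neg-distribˡ-* k (ℤ.+ c))))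
    (trans (cong (λ e → x ℤ.+ e) (ℤ.+-inverseʳ (k ℤ.* ℤ.+ c))) (ℤ.+-identityʳ x))))

module Lines (c d : ℕ) .{{_ : NonZero d}} (coprime : gcd c d ≡ 1) where

  -- d x - c y is constant exactly along the lines in direction (c , d).
  line : Cell → ℤ
  line (i , j) = d * i ⊖ c * j

  translate : ℕ → Cell → Cell
  translate k (i , j) = (k * c + i , k * d + j)

  line-translate : ∀ k p → line (translate k p) ≡ line p
  line-translate k (i , j) = trans (cong₂ _⊖_ (numerator c d i k) (numerator′ c d j k))
                                   (ℤ.+-cancelˡ-⊖ (k * c * d) (d * i) (c * j))
    where
    numerator : ∀ c d i k → d * (k * c + i) ≡ k * c * d + d * i
    numerator = solve-∀
    numerator′ : ∀ c d j k → c * (k * d + j) ≡ k * c * d + c * j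
    numerator′ = solve-∀

  translate-suc : ∀ k p → translate (suc k) p ≡ translate 1 (translate k p)
  translate-suc k (i , j) = cong₂ _,_ (regroup c (k * c) i) (regroup d (k * d) j)
    where
    regroup : ∀ a b i → a + b + i ≡ 1 * a + (b + i)
    regroup = solve-∀

  translate-injective : ∀ k {p q} → translate k p ≡ translate k q → p ≡ q
  translate-injective k {i , j} {i′ , j′} eq = cong₂ _,_
    (+-cancelˡ-≡ (k * c) i i′ (cong proj₁ eq)) (+-cancelˡ-≡ (k * d) j j′ (cong proj₂ eq))

  -- With e and f the increments of the second and first coordinate, d f = c e. As d is coprime to
  -- c, it divides e = k d, and cancelling d gives f = k c. The cells are ordered by the second
  -- coordinate because d > 0, whereas c may be 0.
  collinear : ∀ {p q} → line p ≡ line q → proj₂ p ≤ proj₂ q → ∃ λ k → q ≡ translate k p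
  collinear {i , j} {i′ , j′} same j≤j′ with e , refl ← m≤n⇒∃[o]m+o≡n j≤j′ = fromRun vertical
    where
    open ≡-Reasoning
    vertical : d * i′ ≡ d * i + c * e
    vertical = +-cancelʳ-≡ (c * j) _ _ (trans (sym (⊖≡⊖⇒+≡+ {d * i} {c * j} {d * i′} {c * (j + e)} same)) (regroup (d * i) c j e))
      where
      regroup : ∀ x c j e → x + c * (j + e) ≡ x + c * e + c * j
      regroup = solve-∀
    fromRun : d * i′ ≡ d * i + c * e → ∃ λ k → (i′ , j + e) ≡ translate k (i , j)
    fromRun vertical
      with f , refl ← m≤n⇒∃[o]m+o≡n (*-cancelˡ-≤ {i} {i′} d (≤-trans (m≤m+n (d * i) (c * e)) (≤-reflexive (sym vertical))))
      = multiple (+-cancelˡ-≡ (d * i) _ _ (trans (sym (*-distribˡ-+ d i f)) vertical))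
      where
      multiple : d * f ≡ c * e → ∃ λ k → (i + f , j + e) ≡ translate k (i , j)
      multiple df≡ce
        with divides k refl ← coprime-divisor {n = c} {o = e} (Coprime.sym (gcd≡1⇒coprime coprime))
                                (divides f (trans (sym df≡ce) (*-comm d f)))
        = k , cong₂ _,_ (trans (+-comm i f) (cong (_+ i) f≡kc)) (+-comm j (k * d))
        where
        regroup : ∀ c k d → c * (k * d) ≡ d * (k * c)
        regroup = solve-∀
        f≡kc : f ≡ k * c
        f≡kc = *-cancelˡ-≡ f (k * c) d (trans df≡ce (regroup c k d))

  position : Cell → Point
  position (i , j) = (ℤ.+ suc i , ℤ.+ suc j)

  attacks⇒line≡ : ∀ {p q} → Attacks (c , d) (position p) (position q) → line p ≡ line q
  attacks⇒line≡ (ℤ.+ k , _ , eq) = forward k eq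
    where
    coordinate : ∀ k {x y} a → ℤ.+ suc x ≡ ℤ.+ suc y ℤ.+ ℤ.+ k ℤ.* ℤ.+ a → x ≡ k * a + y
    coordinate k {x} {y} a eq = trans (suc-injective (ℤ.+-injective
      (trans eq (cong (λ e → ℤ.+ suc y ℤ.+ e) (sym (ℤ.pos-* k a)))))) (+-comm y (k * a))
    forward : ∀ {p q} k → position q ≡ position p +[ ℤ.+ k ] (c , d) → line p ≡ line q
    forward {p} k eq =
      sym (trans (cong line (cong₂ _,_ (coordinate k c (cong proj₁ eq)) (coordinate k d (cong proj₂ eq))))
                 (line-translate k p))
  attacks⇒line≡ {p} {q} a@(-[1+ k ] , _ , _) =
    sym (attacks⇒line≡ {q} {p} (ℤ.+ suc k , (λ ()) , proj₂ (proj₂ (attacks-sym a))))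

  translate-attacks : ∀ {k p} → k ≢ 0 → Attacks (c , d) (position p) (position (translate k p))
  translate-attacks {k} {i , j} k≢0 =
    ℤ.+ k , (λ +k≡0 → k≢0 (ℤ.+-injective +k≡0)) , cong₂ _,_ (coordinate i c) (coordinate j d)
    where
    coordinate : ∀ y a → ℤ.+ suc (k * a + y) ≡ ℤ.+ suc y ℤ.+ ℤ.+ k ℤ.* ℤ.+ a
    coordinate y a = trans (cong (λ x → ℤ.+ suc x) (+-comm (k * a) y))
                           (cong (λ e → ℤ.+ suc y ℤ.+ e) (ℤ.pos-* k a))

  line≡⇒attacks : ∀ {p q} → p ≢ q → line p ≡ line q → Attacks (c , d) (position p) (position q)
  line≡⇒attacks {p} {q} p≢q same with ≤-total (proj₂ p) (proj₂ q)
  ... | inj₁ p≤q with k , refl ← collinear same p≤q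
      = translate-attacks {k} {p} λ { refl → p≢q refl }
  ... | inj₂ q≤p with k , refl ← collinear (sym same) q≤p
      = attacks-sym {c , d} {position q} (translate-attacks {k} {q} λ { refl → p≢q refl })

  -- As `U` covers all colours on the board, the clause of `Rainbow` on available colours always
  -- holds; attacking is sharing a line.
  isConfiguration⇔rainbow : ∀ {m n U} q S → (∀ {p} → p ∈ map line (cells m n) → p ∈ U) →
    IsConfiguration (c , d) q m n S ⇔ Rainbow (line ∘ cell m n) U q S
  isConfiguration⇔rainbow {m} {n} {U} q S covers = mk⇔ to from
    where
    cell∈cells : ∀ s → cell m n s ∈ cells m n
    cell∈cells s = ∈-cells⁺ (Fin.toℕ<n (proj₁ (remQuot {m} n s))) (Fin.toℕ<n (proj₂ (remQuot {m} n s)))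
    to : IsConfiguration (c , d) q m n S → Rainbow (line ∘ cell m n) U q S
    to (size , nonAttacking) = size , (λ s _ → covers (∈-map⁺ line (cell∈cells s))) , injective
      where
      injective : ∀ s t → s ∈ₛ S → t ∈ₛ S → line (cell m n s) ≡ line (cell m n t) → s ≡ t
      injective s t s∈ t∈ same with s Fin.≟ t
      ... | yes s≡t = s≡t
      ... | no  s≢t = contradiction (line≡⇒attacks (s≢t ∘ cell-injective m n) same)
                                    (nonAttacking s s∈ t t∈ s≢t)
    from : Rainbow (line ∘ cell m n) U q S → IsConfiguration (c , d) q m n S
    from (size , _ , injective) = size , λ s s∈ t t∈ s≢t attacks →
      s≢t (injective s t s∈ t∈ (attacks⇒line≡ attacks))

  open Counting ℤ._≟_

  u≡esym : ∀ {m n hs} q → Multiplicities (map line (cells m n)) hs → u c d q m n ≡ esym hs q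
  u≡esym {m} {n} {hs} q M = begin
    u c d q m n
      ≡⟨ count-rainbow (line ∘ cell m n) unique q (isConfiguration? c d q m n)
           (λ S → isConfiguration⇔rainbow q S covers) ⟩
    esym (map (count (tabulate (line ∘ cell m n))) values) q
      ≡⟨ cong (λ xs → esym (map (count xs) values) q) (tabulate-remQuot m n id line) ⟩
    esym (map (count (map line (cells m n))) values) q
      ≡⟨ esym-↭ counted q ⟩
    esym hs q ∎
    where
    open ≡-Reasoning
    open Multiplicities M

  -- Peeling off the first cell of every line

  module Peel (m n : ℕ) where

    translate-∈ : ∀ {p} → p ∈ map (translate 1) (cells m n) → p ∈ cells (c + m) (d + n)
    translate-∈ p∈ with (i , j) , ij∈ , refl ← ∈-map⁻ (translate 1) p∈
                   with i<m , j<n ← ∈-cells⁻ m n ij∈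
      rewrite *-identityˡ c | *-identityˡ d = ∈-cells⁺ (+-monoʳ-< c i<m) (+-monoʳ-< d j<n)

    -- The complement ps of the translated board consists of the first cells of
    -- the lines.
    initial : ∃ λ ps → cells (c + m) (d + n) ↭ map (translate 1) (cells m n) ++ ps
    initial = complement (Unique.map⁺ (translate-injective 1) (cells-Unique m n)) translate-∈

    ps : List Cell
    ps = proj₁ initial

    cells↭ : cells (c + m) (d + n) ↭ map (translate 1) (cells m n) ++ ps
    cells↭ = proj₂ initial

    ++-Unique : Unique (map (translate 1) (cells m n) ++ ps)
    ++-Unique = Unique-resp-↭ cells↭ (cells-Unique (c + m) (d + n))

    ps⊆ : ∀ {p} → p ∈ ps → p ∈ cells (c + m) (d + n)
    ps⊆ p∈ = ∈-resp-↭ (↭-sym cells↭) (∈-++⁺ʳ (map (translate 1) (cells m n)) p∈)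

    -- If the (k + 1)-st translate of p is on the large board, then the k-th lies on the small one,
    -- so the former belongs to the translated board and not to its complement.
    not-translate-suc : ∀ k {p} → p ∈ ps → translate (suc k) p ∉ ps
    not-translate-suc k {p@(i , j)} p∈ q∈ with i<m , j<n ← ∈-cells⁻ (c + m) (d + n) (ps⊆ q∈) =
      Unique-++⇒disjoint ++-Unique (subst (_∈ map (translate 1) (cells m n)) (sym (translate-suc k p))
        (∈-map⁺ (translate 1) (∈-cells⁺ (unstep c i<m) (unstep d j<n)))) q∈
      where
      unstep : ∀ a {b i} → suc k * a + i < a + b → k * a + i < b
      unstep a {b} {i} lt = +-cancelˡ-< a _ _ (≤-trans (s≤s (≤-reflexive (sym (+-assoc a (k * a) i)))) lt)

    line-injective : ∀ {p q} → p ∈ ps → q ∈ ps → line p ≡ line q → p ≡ q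
    line-injective {p} {q} p∈ q∈ same with ≤-total (proj₂ p) (proj₂ q)
    ... | inj₁ p≤q with collinear same p≤q
    ...   | zero  , refl = refl
    ...   | suc k , refl = contradiction q∈ (not-translate-suc k p∈)
    line-injective {p} {q} p∈ q∈ same | inj₂ q≤p with collinear (sym same) q≤p
    ...   | zero  , refl = refl
    ...   | suc k , refl = contradiction p∈ (not-translate-suc k q∈)

    -- Walk back along the line: a cell outside `ps` is the translate of a cell of the small board
    -- whose second coordinate is smaller by d > 0. The bound b makes the descent terminate.
    covers : ∀ b {p} → proj₂ p < b → p ∈ cells (c + m) (d + n) → line p ∈ map line ps
    covers (suc b) {p} (s≤s j≤b) p∈ with ∈-++⁻ (map (translate 1) (cells m n)) (∈-resp-↭ cells↭ p∈)
    ... | inj₂ p∈ps = ∈-map⁺ line p∈ps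
    ... | inj₁ p∈ with p′@(i , j) , p′∈ , refl ← ∈-map⁻ (translate 1) p∈
                  with i<m , j<n ← ∈-cells⁻ m n p′∈ =
      subst (_∈ map line ps) (sym (line-translate 1 p′))
        (covers b (≤-trans (+-monoˡ-≤ j (≤-trans (>-nonZero⁻¹ d) (≤-reflexive (sym (*-identityˡ d))))) j≤b)
                  (∈-cells⁺ (≤-trans i<m (m≤n+m m c)) (≤-trans j<n (m≤n+m n d))))

    lines↭ : map line (cells (c + m) (d + n)) ↭ map line (cells m n) ++ map line ps
    lines↭ = ↭-trans (map⁺ line cells↭) (↭-reflexive
      (trans (map-++ line (map (translate 1) (cells m n)) ps)
             (cong (_++ map line ps) (trans (sym (map-∘ (cells m n))) (map-cong (line-translate 1) (cells m n))))))

    length-ps : length (map line ps) + m * n ≡ (c + m) * (d + n)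
    length-ps = begin
      length (map line ps) + m * n                              ≡⟨ +-comm _ (m * n) ⟩
      m * n + length (map line ps)                              ≡⟨ cong (_+ length (map line ps)) (length-lines m n) ⟨
      length (map line (cells m n)) + length (map line ps)      ≡⟨ length-++ (map line (cells m n)) ⟨
      length (map line (cells m n) ++ map line ps)              ≡⟨ ↭-length lines↭ ⟨
      length (map line (cells (c + m) (d + n)))                 ≡⟨ length-lines (c + m) (d + n) ⟩
      (c + m) * (d + n)                                         ∎
      where
      open ≡-Reasoning
      length-lines : ∀ m n → length (map line (cells m n)) ≡ m * n
      length-lines m n = trans (length-map line (cells m n)) (length-cells m n)

    -- The equation on areas fixes e: the complement of the translate has one cell per line, and
    -- `length hs` of these lines are old.
    peel : ∀ {hs} e → Multiplicities (map line (cells m n)) hs → e + length hs + m * n ≡ (c + m) * (d + n) →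
           Multiplicities (map line (cells (c + m) (d + n))) (replicate e 1 ++ map suc hs)
    peel {hs} e M size = multiplicities-++ M lines↭
      (Unique-map⁺ line line-injective (Unique-++⁻ʳ (map (translate 1) (cells m n)) ++-Unique))
      covered
      (+-cancelʳ-≡ (m * n) _ _ (trans length-ps (sym size)))
      where
      covered : ∀ {l} → l ∈ map line (cells (c + m) (d + n)) → l ∈ map line ps
      covered l∈ with p , p∈ , refl ← ∈-map⁻ line l∈ = covers (suc (proj₂ p)) ≤-refl p∈

  -- The multiset of line lengths

  module _ (n̄ r : ℕ) (n̄<d : n̄ < d) where

    private
      -- Equals (c + r)(d + n̄) - 2 r n̄: the r n̄ cells of the smallest board are subtracted once
      -- as area and once as old lines.
      J = (d ∸ n̄) * r + c * (n̄ + d)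

    -- Entry k belongs to the (k c + r) × (k d + n̄) board. The first step stands apart because the
    -- r × n̄ board does not itself arise by peeling.
    lineLengths : ℕ → List ℕ
    lineLengths 0             = replicate (n̄ * r) 1
    lineLengths 1             = replicate J 1 ++ map suc (lineLengths 0)
    lineLengths (suc (suc k)) = replicate (2 * c * d) 1 ++ map suc (lineLengths (suc k))

    J+n̄r : J + length (lineLengths 0) ≡ d * r + c * (n̄ + d)
    J+n̄r = begin
      J + length (lineLengths 0)                       ≡⟨ cong (J +_) (length-replicate (n̄ * r)) ⟩
      (d ∸ n̄) * r + c * (n̄ + d) + n̄ * r                ≡⟨ collect (d ∸ n̄) n̄ r (c * (n̄ + d)) ⟩
      (d ∸ n̄ + n̄) * r + c * (n̄ + d)                    ≡⟨ cong (λ x → x * r + c * (n̄ + d)) (m∸n+n≡m (<⇒≤ n̄<d)) ⟩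
      d * r + c * (n̄ + d)                              ∎
      where
      open ≡-Reasoning
      collect : ∀ x y r z → x * r + z + y * r ≡ (x + y) * r + z
      collect = solve-∀

    length-replicate-++-map : ∀ e hs → length (replicate e 1 ++ map suc hs) ≡ e + length hs
    length-replicate-++-map e hs =
      trans (length-++ (replicate e 1)) (cong₂ _+_ (length-replicate e) (length-map suc hs))

    length-lineLengths : ∀ k → length (lineLengths (suc k)) ≡ k * (2 * c * d) + (d * r + c * (n̄ + d))
    length-lineLengths zero    = trans (length-replicate-++-map J _) J+n̄r
    length-lineLengths (suc k) = begin
      length (lineLengths (suc (suc k)))                               ≡⟨ length-replicate-++-map (2 * c * d) _ ⟩
      2 * c * d + length (lineLengths (suc k))                         ≡⟨ cong (2 * c * d +_) (length-lineLengths k) ⟩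
      2 * c * d + (k * (2 * c * d) + (d * r + c * (n̄ + d)))            ≡⟨ +-assoc (2 * c * d) _ _ ⟨
      suc k * (2 * c * d) + (d * r + c * (n̄ + d))                      ∎
      where open ≡-Reasoning

    multiplicities : ∀ k → Multiplicities (map line (cells (k * c + r) (k * d + n̄))) (lineLengths k)
    multiplicities zero = subst (λ e → Multiplicities (map line (cells r n̄)) (replicate e 1))
      (trans (length-map line (cells r n̄)) (trans (length-cells r n̄) (*-comm r n̄)))
      (multiplicities-Unique (Unique-map⁺ line injective (cells-Unique r n̄)))
      where
      -- A proper forward translate rises by at least d, more than the height n̄ of the board, so no
      -- line has two cells.
      too-far : ∀ k {i j} → translate (suc k) (i , j) ∉ cells r n̄
      too-far k {i} {j} q∈ with _ , j′<n̄ ← ∈-cells⁻ r n̄ q∈ =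
        <⇒≱ (<-trans j′<n̄ n̄<d) (≤-trans (m≤m+n d (k * d)) (m≤m+n (suc k * d) j))
      injective : ∀ {p q} → p ∈ cells r n̄ → q ∈ cells r n̄ → line p ≡ line q → p ≡ q
      injective {p} {q} p∈ q∈ same with ≤-total (proj₂ p) (proj₂ q)
      ... | inj₁ p≤q with collinear same p≤q
      ...   | zero  , refl = refl
      ...   | suc k , refl = contradiction q∈ (too-far k)
      injective {p} {q} p∈ q∈ same | inj₂ q≤p with collinear (sym same) q≤p
      ...   | zero  , refl = refl
      ...   | suc k , refl = contradiction p∈ (too-far k)
    multiplicities (suc k) =
      subst₂ (λ m n → Multiplicities (map line (cells m n)) (lineLengths (suc k)))
        (sym (+-assoc c (k * c) r)) (sym (+-assoc d (k * d) n̄)) (next k (multiplicities k))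
      where
      next : ∀ k → Multiplicities (map line (cells (k * c + r) (k * d + n̄))) (lineLengths k) →
             Multiplicities (map line (cells (c + (k * c + r)) (d + (k * d + n̄)))) (lineLengths (suc k))
      next zero M = Peel.peel r n̄ J M (trans (cong (_+ r * n̄) J+n̄r) (area c d r n̄))
        where
        area : ∀ c d r n̄ → d * r + c * (n̄ + d) + r * n̄ ≡ (c + r) * (d + n̄)
        area = solve-∀
      next (suc k) M = Peel.peel (suc k * c + r) (suc k * d + n̄) (2 * c * d) M
        (trans (cong (λ l → 2 * c * d + l + (suc k * c + r) * (suc k * d + n̄)) (length-lineLengths k))
               (area c d r n̄ k))
        where
        area : ∀ c d r n̄ k →
          2 * c * d + (k * (2 * c * d) + (d * r + c * (n̄ + d))) + ((c + k * c) + r) * ((d + k * d) + n̄)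
          ≡ (c + ((c + k * c) + r)) * (d + ((d + k * d) + n̄))
        area = solve-∀

    -- The 2 c d lines created by a later step are dealt out, one to each staircase: raising `1… k`
    -- by one and putting a 1 in front gives `1… (suc k)`. The two constant blocks are merely
    -- raised.
    lineLengths-↭ : ∀ k → lineLengths (suc k) ↭
      replicate (n̄ * r) (suc k + 1) ++ replicate J (suc k) ++ concat (replicate (2 * c * d) (1… k))
    lineLengths-↭ zero = ↭-trans
      (↭-reflexive (cong (replicate J 1 ++_) (map-replicate suc (n̄ * r) 1)))
      (↭-trans (++-comm (replicate J 1) _)
      (++⁺ˡ (replicate (n̄ * r) 2) (↭-reflexive (sym
        (trans (cong (replicate J 1 ++_) (concat-[] (2 * c * d))) (++-identityʳ _))))))
      where
      concat-[] : ∀ l → concat (replicate l []) ≡ List.[] {A = ℕ}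
      concat-[] zero    = refl
      concat-[] (suc l) = concat-[] l
    lineLengths-↭ (suc k) = ↭-trans (++⁺ˡ ones (map⁺ suc (lineLengths-↭ k)))
      (↭-trans (↭-reflexive (cong (ones ++_) raised))
      (↭-trans (shifts ones (replicate (n̄ * r) (suc (suc k) + 1)))
      (++⁺ˡ (replicate (n̄ * r) (suc (suc k) + 1))
        (↭-trans (shifts ones (replicate J (suc (suc k))))
        (++⁺ˡ (replicate J (suc (suc k)))
          (↭-trans (stack (2 * c * d)) (↭-reflexive
            (cong (λ xs → concat (replicate (2 * c * d) (1 ∷ xs))) (map-applyUpTo suc suc k)))))))))
      where
      ones = replicate (2 * c * d) 1

      raised : map suc (replicate (n̄ * r) (suc k + 1) ++ replicate J (suc k) ++ concat (replicate (2 * c * d) (1… k)))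
             ≡ replicate (n̄ * r) (suc (suc k) + 1) ++ replicate J (suc (suc k)) ++ map suc (concat (replicate (2 * c * d) (1… k)))
      raised = trans (map-++ suc (replicate (n̄ * r) (suc k + 1)) _)
        (cong₂ _++_ (map-replicate suc (n̄ * r) (suc k + 1))
        (trans (map-++ suc (replicate J (suc k)) _)
               (cong (_++ _) (map-replicate suc J (suc k)))))

      stack : ∀ l → replicate l 1 ++ map suc (concat (replicate l (1… k)))
                    ↭ concat (replicate l (1 ∷ map suc (1… k)))
      stack zero    = ↭-refl
      stack (suc l) = prep 1 (↭-trans
        (↭-reflexive (cong (replicate l 1 ++_) (map-++ suc (1… k) _)))
        (↭-trans (shifts (replicate l 1) (map suc (1… k)))
                 (++⁺ˡ (map suc (1… k)) (stack l))))

-- Matching the summand with the blocks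

esymProduct-stirling₁ : ∀ N {l} (xs : Vec ℕ l) →
  esymProduct (Vec.replicate l (1… N)) xs ≡ product (map (λ x → stirling₁ (suc N) (suc N ⊖ x)) (Vec.toList xs))
esymProduct-stirling₁ N []       = refl
esymProduct-stirling₁ N (x ∷ xs) = cong₂ _*_ (sym (stirling₁≡esym N x)) (esymProduct-stirling₁ N xs)

module _ (c d m n : ℕ) .{{_ : NonZero d}} where

  private
    n̄ = n % d
    r = m ∸ c * (n / d)

  -- The blocks stand in the order of the tuple (k , j , x₁ , ...), with N one less than ⌊n/d⌋ so
  -- that the staircases end at N.
  factors : ℕ → Vec (List ℕ) (2 + 2 * c * d)
  factors N = replicate (n̄ * r) (suc N + 1) ∷ replicate ((d ∸ n̄) * r + c * (n̄ + d)) (suc N)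
            ∷ Vec.replicate (2 * c * d) (1… N)

  term≡esymProduct : ∀ {N} → n / d ≡ suc N → term c d m n ≗ esymProduct (factors N)
  term≡esymProduct {N} n/d≡N (k ∷ j ∷ xs) = begin
    ((J C j) * (n / d) ^ j) * (K C k) * (n / d + 1) ^ k
      * product (map (λ x → stirling₁ (n / d) (n / d ⊖ x)) (Vec.toList xs))
      ≡⟨ cong (λ N → ((J C j) * N ^ j) * (K C k) * (N + 1) ^ k
            * product (map (λ x → stirling₁ N (N ⊖ x)) (Vec.toList xs))) n/d≡N ⟩
    ((J C j) * suc N ^ j) * (K C k) * (suc N + 1) ^ k
      * product (map (λ x → stirling₁ (suc N) (suc N ⊖ x)) (Vec.toList xs))
      ≡⟨ cong₂ _*_ (regroup ((J C j) * suc N ^ j) (K C k) _) (sym (esymProduct-stirling₁ N xs)) ⟩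
    ((K C k) * (suc N + 1) ^ k) * ((J C j) * suc N ^ j) * esymProduct (Vec.replicate _ (1… N)) xs
      ≡⟨ *-assoc ((K C k) * (suc N + 1) ^ k) _ _ ⟩
    ((K C k) * (suc N + 1) ^ k) * (((J C j) * suc N ^ j) * esymProduct (Vec.replicate _ (1… N)) xs)
      ≡⟨ cong₂ (λ x y → x * (y * esymProduct (Vec.replicate _ (1… N)) xs))
           (esym-replicate K (suc N + 1) k) (esym-replicate J (suc N) j) ⟨
    esymProduct (factors N) (k ∷ j ∷ xs) ∎
    where
    open ≡-Reasoning
    K = n̄ * r
    J = (d ∸ n̄) * r + c * (n̄ + d)
    regroup : ∀ x y z → x * y * z ≡ y * z * x
    regroup = solve-∀

theorem3p3 : ∀ (m n c d q : ℕ) .{{_ : NonZero m}} .{{_ : NonZero n}} .{{_ : NonZero d}} .{{_ : NonZero q}} →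
    gcd c d ≡ 1 →
    0 < n / d →
    (.{{_ : NonZero c}} → n / d ≤ m / c) →
    u c d q m n ≡ sum (map (term c d m n) (tuplesWithSum (2 + 2 * c * d) q))
theorem3p3 m n c d q coprime 0<n/d n/d≤m/c = main (n / d) refl 0<n/d
  where
  open Lines c d coprime
  open Counting ℤ._≟_
  open ≡-Reasoning
  n̄ = n % d
  r = m ∸ c * (n / d)

  -- Quantified over c so that matching on it supplies the instance needed to use the hypothesis; c
  -- = 0 is the case where ⌊m/c⌋ is read as infinite.
  cN≤m : ∀ c → (.{{_ : NonZero c}} → n / d ≤ m / c) → c * (n / d) ≤ m
  cN≤m zero    _     = z≤n
  cN≤m (suc c) N≤m/c = ≤-trans (≤-reflexive (*-comm (suc c) (n / d)))
    (≤-trans (*-monoˡ-≤ (suc c) N≤m/c) (m/n*n≤m m (suc c)))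

  m≡ : n / d * c + r ≡ m
  m≡ = trans (cong (_+ r) (*-comm (n / d) c)) (m+[n∸m]≡n (cN≤m c n/d≤m/c))

  n≡ : n / d * d + n̄ ≡ n
  n≡ = trans (+-comm (n / d * d) n̄) (sym (m≡m%n+[m/n]*n n d))

  -- The quotient is abstracted so that it can be matched as a successor: the blocks of
  -- `lineLengths-↭` exist only after at least one peel.
  main : ∀ N → n / d ≡ N → 0 < N → u c d q m n ≡ sum (map (term c d m n) (tuplesWithSum (2 + 2 * c * d) q))
  main (suc N) n/d≡N _ = begin
    u c d q m n
      ≡⟨ u≡esym {m} {n} q (subst₂ (λ m′ n′ → Multiplicities (map line (cells m′ n′)) (lineLengths n̄ r (m%n<n n d) (n / d)))
           m≡ n≡ (multiplicities n̄ r (m%n<n n d) (n / d))) ⟩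
    esym (lineLengths n̄ r (m%n<n n d) (n / d)) q
      ≡⟨ cong (λ k → esym (lineLengths n̄ r (m%n<n n d) k) q) n/d≡N ⟩
    esym (lineLengths n̄ r (m%n<n n d) (suc N)) q
      ≡⟨ esym-↭ (lineLengths-↭ n̄ r (m%n<n n d) N) q ⟩
    esym (replicate (n̄ * r) (suc N + 1) ++ replicate ((d ∸ n̄) * r + c * (n̄ + d)) (suc N)
          ++ concat (replicate (2 * c * d) (1… N))) q
      ≡⟨ cong (λ hs → esym (replicate (n̄ * r) (suc N + 1) ++ replicate ((d ∸ n̄) * r + c * (n̄ + d)) (suc N)
          ++ concat hs) q) (toList-replicate (2 * c * d) (1… N)) ⟨
    esym (concat (Vec.toList (factors c d m n N))) q
      ≡⟨ sum-esymProduct (factors c d m n N) q ⟨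
    sum (map (esymProduct (factors c d m n N)) (tuplesWithSum (2 + 2 * c * d) q))
      ≡⟨ cong sum (map-cong (term≡esymProduct c d m n n/d≡N) (tuplesWithSum (2 + 2 * c * d) q)) ⟨
    sum (map (term c d m n) (tuplesWithSum (2 + 2 * c * d) q)) ∎
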